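{- Let $r\ge 2$ and let $F$ be an $r$-graph. If $F$ is $r$-partite, then $\gamma^+(F)=0$.
   Context: An $r$-graph is a finite $r$-uniform hypergraph. It is $r$-partite if its vertex set can be partitioned into $r$ classes $V_1,\dots,V_r$ such that each edge intersects each class in at most one vertex. The minimum positive co-degree $\delta_{r-1}^+(H)$ of a non-empty $r$-graph $H$ is the maximum $k$ such that every $(r-1)$-set of vertices contained in some edge of $H$ is contained in at least $k$ distinct edges of $H$; by convention it is $0$ if $H$ has no edges. A hypergraph is $F$-free if it has no (not necessarily induced) subhypergraph isomorphic to $F$. $\mathrm{co^+ex}(n,F)$ is the maximum of $\delta_{r-1}^+(H)$ over all $n$-vertex $F$-free $r$-graphs $H$ (taken to be $0$ if there are none), and $\gamma^+(F)=\lim_{n\to\infty}\mathrm{co^+ex}(n,F)/n$ (this limit exists). -}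

module Defs where

open import Data.Bool.Base using (Bool; true; false; T; if_then_else_)
open import Data.Bool.Properties as Bool using (T?)
open import Data.Fin.Base using (Fin; finToFun; funToFin)
import Data.Fin.Properties as Fin
open import Data.Fin.Subset using (Subset; inside; outside; _∈_; _⊆_; ∣_∣)
open import Data.Fin.Subset.Properties using (_∈?_; _⊆?_; anySubset?)
open import Data.Integer.Base using (+_)
open import Data.List.Base using (List; []; _∷_; _++_; map; filter; length)
open import Data.List.Extrema.Nat using (max; xs≤max; argmax-sel)
import Data.List.Membership.DecPropositional as DecMembership
import Data.List.Membership.Propositional as List
open import Data.List.Membership.Propositional.Properties
  using (∈-++⁺ˡ; ∈-++⁺ʳ; ∈-map⁺; ∈-map⁻; ∈-filter⁺; ∈-filter⁻)
open import Data.List.Properties using (filter-≐; filter-none)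
import Data.List.Relation.Unary.All as All
open import Data.List.Relation.Unary.Any using (here)
open import Data.List.Relation.Unary.Unique.Propositional using (Unique; []; _∷_)
import Data.List.Relation.Unary.Unique.Propositional.Properties as Unique
open import Data.Nat.Base using (ℕ; zero; suc; _∸_; _≤_; z≤n; s≤s; NonZero)
open import Data.Nat.Properties using (_≟_; _≤?_; ≤-trans; n≤1+n; m≤n⇒m<n∨m≡n)
open import Data.Product.Base using (∃; _×_; _,_; proj₁; proj₂)
open import Data.Rational.Base as ℚ using (ℚ; 0ℚ)
open import Data.Sum.Base using (_⊎_; inj₁; inj₂)
open import Data.Vec.Base as Vec using ([]; _∷_; tabulate)
open import Data.Vec.Properties
  using (≡-dec; tabulate-cong; ∷-injectiveʳ; lookup⇒[]=; []=⇒lookup; lookup∘tabulate)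
open import Function.Base using (_∘_; case_of_)
open import Function.Bundles using (mk⇔)
open import Function.Definitions using (Injective)
open import Level using (Level)
open import Relation.Binary.PropositionalEquality
  using (_≡_; _≗_; refl; sym; trans; cong; subst)
open import Relation.Nullary.Decidable
  using (Dec; yes; no; does; ⌊_⌋; map′; ¬?; _×-dec_; _→-dec_; toWitness; fromWitness;
         decidable-stable; dec-true; does-⇔)
open import Relation.Nullary.Negation using (¬_; contradiction)
open import Relation.Unary using (Decidable; _≐_)

private
  variable
    ℓ : Level
    A : Set ℓ
    P Q : A → Set ℓ
    r m n k : ℕ

allSubset? : {P : Subset n → Set ℓ} → Decidable P → Dec (∀ p → P p)
allSubset? P? = map′
  (λ ∄¬P p → decidable-stable (P? p) (λ ¬Pp → ∄¬P (p , ¬Pp)))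
  (λ ∀P (p , ¬Pp) → ¬Pp (∀P p))
  (¬? (anySubset? (¬? ∘ P?)))

subsets : ∀ n → List (Subset n)
subsets zero    = [] ∷ []
subsets (suc n) = map (outside ∷_) (subsets n) ++ map (inside ∷_) (subsets n)

∈-subsets : (p : Subset n) → p List.∈ subsets n
∈-subsets []                    = here refl
∈-subsets (outside ∷ p)         = ∈-++⁺ˡ (∈-map⁺ (outside ∷_) (∈-subsets p))
∈-subsets {suc n} (inside ∷ p)  =
  ∈-++⁺ʳ (map (outside ∷_) (subsets n)) (∈-map⁺ (inside ∷_) (∈-subsets p))

subsets-unique : ∀ n → Unique (subsets n)
subsets-unique zero    = All.[] ∷ []
subsets-unique (suc n) = Unique.++⁺
  (Unique.map⁺ ∷-injectiveʳ (subsets-unique n))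
  (Unique.map⁺ ∷-injectiveʳ (subsets-unique n))
  λ (p∈ , q∈) → case (∈-map⁻ (outside ∷_) p∈ , ∈-map⁻ (inside ∷_) q∈) of λ where
    ((_ , _ , refl) , (_ , _ , ()))

sublists : List A → List (List A)
sublists []       = [] ∷ []
sublists (x ∷ xs) = sublists xs ++ map (x ∷_) (sublists xs)

filter∈sublists : (P? : Decidable P) (xs : List A) → filter P? xs List.∈ sublists xs
filter∈sublists P? []       = here refl
filter∈sublists P? (x ∷ xs) with does (P? x)
... | false = ∈-++⁺ˡ (filter∈sublists P? xs)
... | true  = ∈-++⁺ʳ (sublists xs) (∈-map⁺ (x ∷_) (filter∈sublists P? xs))

-- The largest k ≤ b satisfying P, and 0 if there is none.
largest : {P : ℕ → Set ℓ} → Decidable P → ℕ → ℕ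
largest P? zero    = zero
largest P? (suc b) = if does (P? (suc b)) then suc b else largest P? b

largest-upper : {P : ℕ → Set ℓ} (P? : Decidable P) (b : ℕ) → k ≤ b → P k → k ≤ largest P? b
largest-upper P? zero    k≤b Pk = k≤b
largest-upper P? (suc b) k≤b Pk with P? (suc b) | m≤n⇒m<n∨m≡n k≤b
... | yes _  | _              = k≤b
... | no _   | inj₁ (s≤s k≤b′) = largest-upper P? b k≤b′ Pk
... | no ¬P  | inj₂ refl      = contradiction Pk ¬P

largest-satisfies : {P : ℕ → Set ℓ} (P? : Decidable P) (b : ℕ) → P 0 → P (largest P? b)
largest-satisfies P? zero    P0 = P0
largest-satisfies P? (suc b) P0 with P? (suc b)
... | yes Pb = Pb
... | no _   = largest-satisfies P? b P0

largest-cong : {P Q : ℕ → Set ℓ} (P? : Decidable P) (Q? : Decidable Q) →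
               P ≐ Q → largest P? ≗ largest Q?
largest-cong P? Q? P≐Q zero    = refl
largest-cong P? Q? P≐Q (suc b) with P? (suc b) | Q? (suc b)
... | yes _ | yes _  = refl
... | yes p | no ¬q  = contradiction (proj₁ P≐Q p) ¬q
... | no ¬p | yes q  = contradiction (proj₂ P≐Q q) ¬p
... | no _  | no _   = largest-cong P? Q? P≐Q b

-- r-graphs with vertex set Fin n.
record RGraph (r n : ℕ) : Set where
  field
    isEdge : Subset n → Bool

  Edge : Subset n → Set
  Edge e = T (isEdge e)

  field
    uniform : ∀ {e} → Edge e → ∣ e ∣ ≡ r

  Edge? : Decidable Edge
  Edge? e = T? (isEdge e)

open RGraph public

-- Classes may be empty.
RPartite : RGraph r n → Set
RPartite {r} {n} H =
  ∃ λ (class : Fin n → Fin r) →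
    ∀ {e} → Edge H e → ∀ {x y} → x ∈ e → y ∈ e → class x ≡ class y → x ≡ y

preimage? : (f : Fin m → Fin n) (p : Subset m) (j : Fin n) → Dec (∃ λ i → i ∈ p × f i ≡ j)
preimage? f p j = Fin.any? λ i → (i ∈? p) ×-dec (f i Fin.≟ j)

image : (Fin m → Fin n) → Subset m → Subset n
image f p = tabulate (does ∘ preimage? f p)

∈-image⁺ : (f : Fin m → Fin n) {p : Subset m} → ∀ {i} → i ∈ p → f i ∈ image f p
∈-image⁺ f {p} {i} i∈p = lookup⇒[]= (f i) (image f p)
  (trans (lookup∘tabulate _ (f i)) (dec-true (preimage? f p (f i)) (i , i∈p , refl)))

∈-image⁻ : (f : Fin m → Fin n) {p : Subset m} → ∀ {j} → j ∈ image f p →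
           ∃ λ i → i ∈ p × f i ≡ j
∈-image⁻ f {p} {j} j∈
  with preimage? f p j
     | trans (sym (lookup∘tabulate (does ∘ preimage? f p) j)) ([]=⇒lookup j∈)
... | yes i | _  = i
... | no  _ | ()

IsEmbedding : RGraph r m → RGraph r n → (Fin m → Fin n) → Set
IsEmbedding F H f = Injective _≡_ _≡_ f × (∀ e → Edge F e → Edge H (image f e))

-- H has a (not necessarily induced) subhypergraph isomorphic to F.
Contains : RGraph r n → RGraph r m → Set
Contains H F = ∃ (IsEmbedding F H)

Free : RGraph r m → RGraph r n → Set
Free F H = ¬ Contains H F

IsEmbedding-cong : (F : RGraph r m) (H : RGraph r n) {f g : Fin m → Fin n} →
                   f ≗ g → IsEmbedding F H f → IsEmbedding F H g
IsEmbedding-cong F H {f} {g} f≗g (inj , pres) =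
    (λ {x} {y} gx≡gy → inj (trans (f≗g x) (trans gx≡gy (sym (f≗g y)))))
  , λ e Fe → subst (Edge H) (image-cong e) (pres e Fe)
  where
  image-cong : ∀ e → image f e ≡ image g e
  image-cong e = tabulate-cong λ j →
    does-⇔
      (mk⇔ (λ (i , i∈e , eq) → i , i∈e , trans (sym (f≗g i)) eq)
           (λ (i , i∈e , eq) → i , i∈e , trans (f≗g i) eq))
      (preimage? f e j) (preimage? g e j)

IsEmbedding? : (F : RGraph r m) (H : RGraph r n) → Decidable (IsEmbedding F H)
IsEmbedding? F H f =
  map′ (λ inj {x} {y} → inj x y) (λ inj x y → inj)
    (Fin.all? λ x → Fin.all? λ y → (f x Fin.≟ f y) →-dec (x Fin.≟ y))
  ×-dec allSubset? (λ e → Edge? F e →-dec Edge? H (image f e))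

Contains? : (H : RGraph r n) (F : RGraph r m) → Dec (Contains H F)
Contains? H F = map′
  (λ (i , emb) → finToFun i , emb)
  (λ (f , emb) → funToFin f , IsEmbedding-cong F H (sym ∘ Fin.finToFun-funToFin f) emb)
  (Fin.any? (IsEmbedding? F H ∘ finToFun))

Free? : (F : RGraph r m) → Decidable (Free {n = n} F)
Free? F H = ¬? (Contains? H F)

size : RGraph r n → ℕ
size {n = n} H = length (filter (Edge? H) (subsets n))

degree : RGraph r n → Subset n → ℕ
degree {n = n} H s = length (filter (λ e → Edge? H e ×-dec (s ⊆? e)) (subsets n))

CodegreeAtLeast : RGraph r n → ℕ → Set
CodegreeAtLeast {r} H k =
  ∀ s → ∣ s ∣ ≡ r ∸ 1 → (∃ λ e → Edge H e × s ⊆ e) → k ≤ degree H s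

CodegreeAtLeast? : (H : RGraph r n) → Decidable (CodegreeAtLeast H)
CodegreeAtLeast? {r} H k = allSubset? λ s →
  (∣ s ∣ ≟ r ∸ 1) →-dec
  (anySubset? (λ e → Edge? H e ×-dec (s ⊆? e)) →-dec (k ≤? degree H s))

-- If H has an edge, every k with CodegreeAtLeast H k is at most size H, so the
-- bound does not affect the maximum; if H has no edge, the bound is 0 and so is δ⁺ H.
δ⁺ : RGraph r n → ℕ
δ⁺ H = largest (CodegreeAtLeast? H) (size H)

fromList : ∀ r → List (Subset n) → RGraph r n
fromList r es = record
  { isEdge  = λ e → ⌊ (∣ e ∣ ≟ r) ×-dec (e ∈ₗ? es) ⌋
  ; uniform = λ {e} → proj₁ ∘ toWitness {a? = (∣ e ∣ ≟ r) ×-dec (e ∈ₗ? es)}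
  }
  where open DecMembership (≡-dec Bool._≟_) using () renaming (_∈?_ to _∈ₗ?_)

-- Every r-graph on Fin n occurs here, possibly with repetitions.
rGraphs : ∀ r n → List (RGraph r n)
rGraphs r n = map (fromList r) (sublists (subsets n))

co⁺ex : ℕ → RGraph r m → ℕ
co⁺ex {r} n F = max 0 (map δ⁺ (filter (Free? F) (rGraphs r n)))

-- L is the limit of a sequence indexed by the positive integers.  Letting ε range
-- over the positive rationals is equivalent to letting it range over the positive reals.
_⟶_ : ((n : ℕ) → .{{NonZero n}} → ℚ) → ℚ → Set
a ⟶ L = ∀ ε → 0ℚ ℚ.< ε →
  ∃ λ N → ∀ n → .{{_ : NonZero n}} → N ≤ n → ℚ.∣ a n ℚ.- L ∣ ℚ.< ε

infix 4 _⟶_ γ⁺[_]≡_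

-- The density is a real number in general; this is the assertion that it equals
-- a given rational.
γ⁺[_]≡_ : RGraph r m → ℚ → Set
γ⁺[ F ]≡ L = (λ n → + co⁺ex n F ℚ./ n) ⟶ L

_≈_ : RGraph r n → RGraph r n → Set
H ≈ G = Edge H ≐ Edge G

rGraphs-complete : (H : RGraph r n) → ∃ λ G → G List.∈ rGraphs r n × H ≈ G
rGraphs-complete {r} {n} H =
    fromList r es
  , ∈-map⁺ (fromList r) (filter∈sublists (Edge? H) (subsets n))
  , (λ {e} He → fromWitness {a? = (∣ e ∣ ≟ r) ×-dec (e ∈ₗ? es)}
                  (uniform H He , ∈-filter⁺ (Edge? H) (∈-subsets e) He))
  , λ {e} Ge → proj₂ (∈-filter⁻ (Edge? H) {xs = subsets n}
                  (proj₂ (toWitness {a? = (∣ e ∣ ≟ r) ×-dec (e ∈ₗ? es)} Ge)))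
  where
  open DecMembership (≡-dec Bool._≟_) using () renaming (_∈?_ to _∈ₗ?_)
  es = filter (Edge? H) (subsets n)

degree-cong : (H G : RGraph r n) → H ≈ G → degree H ≗ degree G
degree-cong {n = n} H G (H⊆G , G⊆H) s = cong length
  (filter-≐ (λ e → Edge? H e ×-dec (s ⊆? e)) (λ e → Edge? G e ×-dec (s ⊆? e))
    ((λ (He , s⊆e) → H⊆G He , s⊆e) , (λ (Ge , s⊆e) → G⊆H Ge , s⊆e)) (subsets n))

CodegreeAtLeast-cong : (H G : RGraph r n) → H ≈ G → ∀ {k} → CodegreeAtLeast H k → CodegreeAtLeast G k
CodegreeAtLeast-cong H G H≈G {k} c s ∣s∣ (e , Ge , s⊆e) =
  subst (k ≤_) (degree-cong H G H≈G s) (c s ∣s∣ (e , proj₂ H≈G Ge , s⊆e))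

δ⁺-cong : (H G : RGraph r n) → H ≈ G → δ⁺ H ≡ δ⁺ G
δ⁺-cong {n = n} H G H≈G@(H⊆G , G⊆H) = trans
  (largest-cong (CodegreeAtLeast? H) (CodegreeAtLeast? G)
    (CodegreeAtLeast-cong H G H≈G , CodegreeAtLeast-cong G H (G⊆H , H⊆G)) (size H))
  (cong (largest (CodegreeAtLeast? G) ∘ length)
    (filter-≐ (Edge? H) (Edge? G) H≈G (subsets n)))

δ⁺-satisfies : (H : RGraph r n) → CodegreeAtLeast H (δ⁺ H)
δ⁺-satisfies H = largest-satisfies (CodegreeAtLeast? H) (size H) λ _ _ _ → z≤n

private
  length-filter-mono : (P? : Decidable P) (Q? : Decidable Q) → (∀ {x} → P x → Q x) →
                       (xs : List A) → length (filter P? xs) ≤ length (filter Q? xs)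
  length-filter-mono P? Q? P⊆Q []       = z≤n
  length-filter-mono P? Q? P⊆Q (x ∷ xs) with P? x | Q? x
  ... | yes _ | yes _ = s≤s (length-filter-mono P? Q? P⊆Q xs)
  ... | yes p | no ¬q = contradiction (P⊆Q p) ¬q
  ... | no _  | yes _ = ≤-trans (length-filter-mono P? Q? P⊆Q xs) (n≤1+n _)
  ... | no _  | no _  = length-filter-mono P? Q? P⊆Q xs

  shrink : (e : Subset n) → ∃ λ s → ∣ s ∣ ≡ ∣ e ∣ ∸ 1 × s ⊆ e
  shrink []            = [] , refl , λ ()
  shrink (inside ∷ e)  = outside ∷ e , refl , λ { (Vec.there x∈) → Vec.there x∈ }
  shrink (outside ∷ e) with s , ∣s∣ , s⊆e ← shrink e =
    outside ∷ s , ∣s∣ , λ { (Vec.there x∈) → Vec.there (s⊆e x∈) }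

δ⁺-maximal : (H : RGraph r n) → ∃ (Edge H) → CodegreeAtLeast H k → k ≤ δ⁺ H
δ⁺-maximal {n = n} H (e , He) c with s , ∣s∣ , s⊆e ← shrink e =
  largest-upper (CodegreeAtLeast? H) (size H)
    (≤-trans (c s (trans ∣s∣ (cong (_∸ 1) (uniform H He))) (e , He , s⊆e))
      (length-filter-mono (λ e → Edge? H e ×-dec (s ⊆? e)) (Edge? H) proj₁ (subsets n)))
    c

δ⁺-empty : (H : RGraph r n) → ¬ ∃ (Edge H) → δ⁺ H ≡ 0
δ⁺-empty {n = n} H ∄e = cong (largest (CodegreeAtLeast? H) ∘ length)
  (filter-none (Edge? H) (All.universal (λ e He → ∄e (e , He)) (subsets n)))

Free-cong : (F : RGraph r m) (H G : RGraph r n) → H ≈ G → Free F H → Free F G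
Free-cong F H G (_ , G⊆H) free (f , inj , pres) = free (f , inj , λ e Fe → G⊆H (pres e Fe))

co⁺ex-upper : (F : RGraph r m) (H : RGraph r n) → Free F H → δ⁺ H ≤ co⁺ex n F
co⁺ex-upper {r} {n = n} F H free with G , G∈ , H≈G ← rGraphs-complete H =
  subst (_≤ co⁺ex n F) (sym (δ⁺-cong H G H≈G))
    (All.lookup (xs≤max 0 _)
      (∈-map⁺ δ⁺ (∈-filter⁺ (Free? F) G∈ (Free-cong F H G H≈G free))))

co⁺ex-attained : ∀ n (F : RGraph r m) →
  co⁺ex n F ≡ 0 ⊎ ∃ λ (H : RGraph r n) → Free F H × co⁺ex n F ≡ δ⁺ H
co⁺ex-attained {r} n F
  with argmax-sel (λ k → k) 0 (map δ⁺ (filter (Free? F) (rGraphs r n)))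
... | inj₁ ≡0 = inj₁ ≡0
... | inj₂ k∈ with H , H∈ , ≡δ⁺ ← ∈-map⁻ δ⁺ k∈ =
  inj₂ (H , proj₂ (∈-filter⁻ (Free? F) {xs = rGraphs r n} H∈) , ≡δ⁺)

{-# OPTIONS --safe #-}

-- Suppose H has an edge and δ⁺(H) ≥ n/d.  Starting from the empty set, a set of fewer than r
-- vertices contained in an edge can be extended inside edges by at least n/d vertices, so
-- at least (n/d)^r of the n^r ordered r-tuples span an edge.  For fixed d and large n,
-- Erdős's theorem on dense r-partite patterns then yields a complete r-partite
-- subhypergraph with parts of size m = |V(F)|, and this contains F.

module Submission where

open import Defs
open import Data.Fin.Base using (Fin; zero; suc)
import Data.Fin.Properties as Fin
open import Data.Fin.Subset
  using (Subset; inside; outside; _∈_; _∉_; _⊆_; ∣_∣; ⊥; ⁅_⁆; _∪_; _-_)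
open import Data.Fin.Subset.Properties
  using (_∈?_; _⊆?_; anySubset?; ⊆-antisym; ⊆-min; p⊆q⇒∣p∣≤∣q∣; p⊂q⇒∣p∣<∣q∣; ∪-identityʳ;
         p⊆p∪q; q⊆p∪q; x∈p∪q⁻; x∈⁅x⁆; x∈⁅y⁆⇒x≡y; p─q⊆p; x∈p∧x≢y⇒x∈p-y; ∣⊥∣≡0)
import Data.Integer.Base as ℤ
import Data.Integer.Properties as ℤ
open import Data.List.Base as List
  using (List; []; _∷_; map; filter; length; take; cartesianProductWith; allFin)
open import Data.List.Membership.Propositional using () renaming (_∈_ to _∈ₗ_)
open import Data.List.Membership.Propositional.Properties
  using (∈-lookup; ∈-map⁺; ∈-filter⁺; ∈-filter⁻; ∈-allFin)
import Data.List.Membership.Setoid.Properties as Membership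
open import Data.List.Properties
  using (filter-++; filter-all; filter-accept; length-++; length-filter; length-map;
         length-tabulate; length-take)
open import Data.List.Relation.Binary.Sublist.Propositional
  using ([]; _∷_; _∷ʳ_; minimum) renaming (_⊆_ to _⊑_; ⊆-trans to ⊑-trans)
open import Data.List.Relation.Binary.Sublist.Propositional.Properties
  using (All-resp-⊆; take-⊆; filter-⊆)
open import Data.List.Relation.Unary.All as All using (All; []; _∷_)
open import Data.List.Relation.Unary.All.Properties using (all-filter)
open import Data.List.Relation.Unary.Any using (index)
open import Data.List.Relation.Unary.Unique.Propositional using (Unique; []; _∷_)
import Data.List.Relation.Unary.Unique.Propositional.Properties as Unique
open import Data.Nat.Base hiding (∣_-_∣)
open import Data.Nat.ListAction using (sum)
open import Data.Nat.Properties
open import Data.Nat.Solver using (module +-*-Solver)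
open import Data.Product.Base using (∃; _×_; _,_; proj₁; proj₂)
open import Data.Rational.Base as ℚ using (mkℚ; 0ℚ)
import Data.Rational.Properties as ℚ
import Data.Rational.Unnormalised.Base as ℚᵘ
import Data.Rational.Unnormalised.Properties as ℚᵘ
open import Data.Sum.Base using (_⊎_; inj₁; inj₂; [_,_]′)
open import Data.Vec.Base using (Vec; []; _∷_; here; there; lookup; tabulate)
open import Data.Vec.Properties using (lookup∘tabulate)
open import Data.Vec.Relation.Binary.Pointwise.Inductive using (Pointwise; []; _∷_)
import Data.Vec.Relation.Unary.All as VecAll
import Data.Vec.Relation.Unary.All.Properties as VecAll
open import Function.Base using (_∘_)
open import Function.Definitions using (Injective)
open import Relation.Binary.PropositionalEquality
open import Relation.Nullary.Decidable using (Dec; yes; no; ¬?; _×-dec_)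
open import Relation.Nullary.Negation using (contradiction)
open import Relation.Unary using (Decidable)

private
  variable
    A B C : Set
    P Q : A → Set
    m n r : ℕ
    p q : Subset n

-- Lists without repetition.

All-head-≢ : {x : A} {xs : List A} → All (x ≢_) xs → ∀ i → x ≢ List.lookup xs i
All-head-≢ (x≢ ∷ _)   zero    = x≢
All-head-≢ (_ ∷ x≢xs) (suc i) = All-head-≢ x≢xs i

lookup-injective : {xs : List A} → Unique xs → ∀ {i j} → List.lookup xs i ≡ List.lookup xs j → i ≡ j
lookup-injective (_ ∷ _)      {zero}  {zero}  _  = refl
lookup-injective (x≢xs ∷ _)   {zero}  {suc j} eq = contradiction eq (All-head-≢ x≢xs j)
lookup-injective (x≢xs ∷ _)   {suc i} {zero}  eq = contradiction (sym eq) (All-head-≢ x≢xs i)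
lookup-injective (_ ∷ unique) {suc i} {suc j} eq = cong suc (lookup-injective unique eq)

-- Each position in `xs` is sent to a position of the same element in `ys`; this map of finite index
-- types is injective.
Unique⇒length≤ : {xs ys : List A} → Unique xs → (∀ {x} → x ∈ₗ xs → x ∈ₗ ys) → length xs ≤ length ys
Unique⇒length≤ {A} {xs = xs} unique xs⊆ys = Fin.injective⇒≤
  {f = λ i → index (xs⊆ys (∈-lookup {xs = xs} i))}
  (λ eq → lookup-injective unique (Membership.index-injective (setoid A) _ _ eq))

Unique-resp-⊑ : {xs ys : List A} → xs ⊑ ys → Unique ys → Unique xs
Unique-resp-⊑ []            []               = []
Unique-resp-⊑ (_ ∷ʳ xs⊑ys)  (_ ∷ unique)     = Unique-resp-⊑ xs⊑ys unique
Unique-resp-⊑ (refl ∷ xs⊑ys) (y≢ys ∷ unique) = All-resp-⊆ xs⊑ys y≢ys ∷ Unique-resp-⊑ xs⊑ys unique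

-- Counting in lists.

count : {P : A → Set} → Decidable P → List A → ℕ
count P? xs = length (filter P? xs)

count-mono : (P? : Decidable P) (Q? : Decidable Q) → (∀ {x} → P x → Q x) →
             ∀ (xs : List A) → count P? xs ≤ count Q? xs
count-mono P? Q? P⊆Q []       = z≤n
count-mono P? Q? P⊆Q (x ∷ xs) with P? x | Q? x
... | yes _ | yes _ = s≤s (count-mono P? Q? P⊆Q xs)
... | yes p | no ¬q = contradiction (P⊆Q p) ¬q
... | no _  | yes _ = m≤n⇒m≤1+n (count-mono P? Q? P⊆Q xs)
... | no _  | no _  = count-mono P? Q? P⊆Q xs

count-split : (P? : Decidable P) (Q? : Decidable Q) (xs : List A) →
  count P? xs ≡ count P? (filter Q? xs) + count P? (filter (¬? ∘ Q?) xs)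
count-split P? Q? []       = refl
count-split P? Q? (x ∷ xs) with Q? x
... | yes _ with P? x
...   | yes _ = cong suc (count-split P? Q? xs)
...   | no _  = count-split P? Q? xs
count-split P? Q? (x ∷ xs) | no _ with P? x
...   | yes _ = trans (cong suc (count-split P? Q? xs)) (sym (+-suc _ _))
...   | no _  = count-split P? Q? xs

length-split : (Q? : Decidable Q) (xs : List A) → length xs ≡ count Q? xs + count (¬? ∘ Q?) xs
length-split Q? []       = refl
length-split Q? (x ∷ xs) with Q? x
... | yes _ = cong suc (length-split Q? xs)
... | no _  = trans (cong suc (length-split Q? xs)) (sym (+-suc _ _))

count-filter-≤ : (P? : Decidable P) (Q? : Decidable Q) (xs : List A) →
                 count P? (filter Q? xs) ≤ count P? xs
count-filter-≤ P? Q? xs = ≤-trans (m≤m+n _ _) (≤-reflexive (sym (count-split P? Q? xs)))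

count-map : {P : B → Set} (P? : Decidable P) (f : A → B) (xs : List A) →
            count P? (map f xs) ≡ count (P? ∘ f) xs
count-map P? f []       = refl
count-map P? f (x ∷ xs) with P? (f x)
... | yes _ = cong suc (count-map P? f xs)
... | no _  = count-map P? f xs

count-cartesianProductWith : {P : C → Set} (P? : Decidable P) (f : A → B → C) →
  ∀ (xs : List A) (ys : List B) →
  count P? (cartesianProductWith f xs ys) ≡ sum (map (λ x → count (P? ∘ f x) ys) xs)
count-cartesianProductWith P? f []       ys = refl
count-cartesianProductWith P? f (x ∷ xs) ys = begin
  count P? (map (f x) ys List.++ cartesianProductWith f xs ys)
    ≡⟨ cong length (filter-++ P? (map (f x) ys) _) ⟩
  length (filter P? (map (f x) ys) List.++ filter P? (cartesianProductWith f xs ys))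
    ≡⟨ length-++ (filter P? (map (f x) ys)) ⟩
  count P? (map (f x) ys) + count P? (cartesianProductWith f xs ys)
    ≡⟨ cong₂ _+_ (count-map P? (f x) ys) (count-cartesianProductWith P? f xs ys) ⟩
  count (P? ∘ f x) ys + sum (map (λ x → count (P? ∘ f x) ys) xs) ∎
  where open ≡-Reasoning

length-cartesianProductWith : (f : A → B → C) (xs : List A) (ys : List B) →
  length (cartesianProductWith f xs ys) ≡ length xs * length ys
length-cartesianProductWith f []       ys = refl
length-cartesianProductWith f (x ∷ xs) ys = trans (length-++ (map (f x) ys))
  (cong₂ _+_ (length-map (f x) ys) (length-cartesianProductWith f xs ys))

sum-map-+ : (f g h : A → ℕ) → (∀ x → f x ≡ g x + h x) → ∀ xs →
            sum (map f xs) ≡ sum (map g xs) + sum (map h xs)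
sum-map-+ f g h f≡g+h []       = refl
sum-map-+ f g h f≡g+h (x ∷ xs) = trans (cong₂ _+_ (f≡g+h x) (sum-map-+ f g h f≡g+h xs))
  (solve 4 (λ a b c d → (a :+ b) :+ (c :+ d) := (a :+ c) :+ (b :+ d)) refl (g x) (h x) _ _)
  where open +-*-Solver

sum-map-≤ : (f : A → ℕ) {c : ℕ} → (∀ x → f x ≤ c) → ∀ xs → sum (map f xs) ≤ length xs * c
sum-map-≤ f f≤c []       = z≤n
sum-map-≤ f f≤c (x ∷ xs) = +-mono-≤ (f≤c x) (sum-map-≤ f f≤c xs)

-- Markov's inequality in product form: elements outside `P` add nothing on the left. The factor `e`
-- permits a fractional lower bound c / e for `f`.
count*≤*sum : (P? : Decidable P) (f : A → ℕ) (e c : ℕ) → (∀ {x} → P x → c ≤ e * f x) →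
              ∀ xs → count P? xs * c ≤ e * sum (map f xs)
count*≤*sum P? f e c low []       = z≤n
count*≤*sum P? f e c low (x ∷ xs) rewrite *-distribˡ-+ e (f x) (sum (map f xs)) with P? x
... | yes p = +-mono-≤ (low p) (count*≤*sum P? f e c low xs)
... | no _  = ≤-trans (count*≤*sum P? f e c low xs) (m≤n+m _ _)

-- Common neighbours in a bipartite graph.

module _ {X Y : Set} {R : X → Y → Set} (R? : ∀ x → Decidable (R x)) where

  common? : ∀ S → Decidable (λ y → All (λ x → R x y) S)
  common? S y = All.all? (λ x → R? x y) S

  -- The number of edges between `xs` and `ys` in the bipartite graph of `R`, counted with
  -- multiplicity.
  degreeSum : List X → List Y → ℕ
  degreeSum xs ys = sum (map (λ x → count (R? x) ys) xs)

  degreeSum-split : {Q : Y → Set} (Q? : Decidable Q) → ∀ xs ys →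
    degreeSum xs ys ≡ degreeSum xs (filter Q? ys) + degreeSum xs (filter (¬? ∘ Q?) ys)
  degreeSum-split Q? xs ys = sum-map-+ _ _ _ (λ x → count-split (R? x) Q? ys) xs

  degreeSum≤ : ∀ xs ys → degreeSum xs ys ≤ length xs * length ys
  degreeSum≤ xs ys = sum-map-≤ _ (λ x → length-filter (R? x) ys) xs

  count-common-∷ : ∀ x S ys → count (common? S) (filter (R? x) ys) ≤ count (common? (x ∷ S)) ys
  count-common-∷ x S []       = z≤n
  count-common-∷ x S (y ∷ ys) with R? x y
  ... | no _ = count-common-∷ x S ys
  ... | yes r with common? S y
  ...   | yes _ = s≤s (count-common-∷ x S ys)
  ...   | no _  = count-common-∷ x S ys

  -- Pigeonhole: if the x ∈ xs have large degrees into ys on average, some m of them have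
  -- many common neighbours.  The induction splits ys at the neighbourhood of the first x;
  -- the term length ys on the left stands in for m ∸ 1 on the right, and D avoids a division.
  commonNeighbours : ∀ (c D m : ℕ) xs ys →
    (∃ λ S → S ⊑ xs × length S ≡ m × c ≤ D * count (common? S) ys)
    ⊎ D * (degreeSum xs ys + length ys) ≤ D * (m * length ys) + 2 ^ length xs * c
  -- The empty set has all of `ys` as common neighbours. If these are too few, the trivial bound on
  -- the degree sum and 1 + t ≤ 2 ^ t suffice.
  commonNeighbours c D zero xs ys with c ≤? D * length ys
  ... | yes c≤ = inj₁ ([] , minimum xs , refl ,
    subst (λ zs → c ≤ D * length zs)
      (sym (filter-all (common? []) (All.universal (λ _ → []) ys))) c≤)
  ... | no c≰ = inj₂ (begin
    D * (degreeSum xs ys + length ys)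
      ≤⟨ *-monoʳ-≤ D (+-monoˡ-≤ _ (degreeSum≤ xs ys)) ⟩
    D * (length xs * length ys + length ys)
      ≡⟨ solve 3 (λ D t l → D :* (t :* l :+ l) := (con 1 :+ t) :* (D :* l)) refl
           D (length xs) (length ys) ⟩
    suc (length xs) * (D * length ys)
      ≤⟨ *-mono-≤ (1+n≤2^n (length xs)) (<⇒≤ (≰⇒> c≰)) ⟩
    2 ^ length xs * c
      ≤⟨ m≤n+m _ _ ⟩
    D * (0 * length ys) + 2 ^ length xs * c ∎)
    where
    open ≤-Reasoning
    open +-*-Solver
    1+n≤2^n : ∀ t → suc t ≤ 2 ^ t
    1+n≤2^n zero    = ≤-refl
    1+n≤2^n (suc t) = +-mono-≤ (m^n>0 2 t) (≤-trans (1+n≤2^n t) (m≤m+n _ 0))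
  commonNeighbours c D (suc m) [] ys =
    inj₂ (≤-trans (*-monoʳ-≤ D (m≤m+n (length ys) _)) (m≤m+n _ _))
  commonNeighbours c D (suc m) (x ∷ xs) ys
    with commonNeighbours c D m xs (filter (R? x) ys)
       | commonNeighbours c D (suc m) xs (filter (¬? ∘ R? x) ys)
  ... | inj₁ (S , S⊑ , ∣S∣ , c≤) | _ = inj₁ (x ∷ S , refl ∷ S⊑ , cong suc ∣S∣ ,
          ≤-trans c≤ (*-monoʳ-≤ D (count-common-∷ x S ys)))
  ... | inj₂ _ | inj₁ (S , S⊑ , ∣S∣ , c≤) = inj₁ (S , x ∷ʳ S⊑ , ∣S∣ ,
          ≤-trans c≤ (*-monoʳ-≤ D (count-filter-≤ (common? S) (¬? ∘ R? x) ys)))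
  ... | inj₂ le₁ | inj₂ le₂
    rewrite degreeSum-split (R? x) xs ys | length-split (R? x) ys
    = inj₂ bound
    where
    open ≤-Reasoning
    open +-*-Solver
    a = count (R? x) ys
    b = count (¬? ∘ R? x) ys
    s₁ = degreeSum xs (filter (R? x) ys)
    s₂ = degreeSum xs (filter (¬? ∘ R? x) ys)
    K = 2 ^ length xs
    -- On the neighbourhood of `x` only `m` further elements were sought, which leaves room for the
    -- term `D * a` from the degree of `x`; the two error terms `K * c` add up to the next power of
    -- 2.
    bound = begin
      D * (a + (s₁ + s₂) + (a + b))
        ≡⟨ solve 5 (λ D a b s t → D :* (a :+ (s :+ t) :+ (a :+ b))
             := (D :* (s :+ a) :+ D :* (t :+ b)) :+ D :* a) refl D a b s₁ s₂ ⟩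
      D * (s₁ + a) + D * (s₂ + b) + D * a
        ≤⟨ +-monoˡ-≤ (D * a) (+-mono-≤ le₁ le₂) ⟩
      D * (m * a) + K * c + (D * (suc m * b) + K * c) + D * a
        ≡⟨ solve 6 (λ D m a b K c →
             D :* (m :* a) :+ K :* c :+ (D :* ((con 1 :+ m) :* b) :+ K :* c) :+ D :* a
             := D :* ((con 1 :+ m) :* (a :+ b)) :+ (con 2 :* K) :* c) refl D m a b K c ⟩
      D * (suc m * (a + b)) + 2 * K * c ∎

-- Averaging, and complete r-partite blocks in dense r-ary relations.

-- After scaling by 2d the sum is at least twice `length xs * M`. Elements that are not dense
-- contribute less than `M` each, at most `length xs * M` together, so the dense ones, contributing
-- at most 2dM each, must supply the rest.
length≤*count-dense : (f : A → ℕ) (M d : ℕ) → .{{NonZero M}} → (∀ x → f x ≤ M) →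
  (dense? : Decidable (λ x → M ≤ 2 * d * f x)) → ∀ xs →
  length xs * M ≤ d * sum (map f xs) → length xs ≤ 2 * d * count dense? xs
length≤*count-dense f M d f≤M dense? xs large =
  *-cancelʳ-≤ _ _ M (+-cancelʳ-≤ (length xs * M) _ _ (begin
    length xs * M + length xs * M
      ≤⟨ +-mono-≤ large large ⟩
    d * s + d * s
      ≡⟨ solve 2 (λ d s → d :* s :+ d :* s := con 2 :* d :* s) refl d s ⟩
    2 * d * s
      ≤⟨ bound xs ⟩
    2 * d * count dense? xs * M + length xs * M ∎))
  where
  open ≤-Reasoning
  open +-*-Solver
  s = sum (map f xs)
  bound : ∀ xs → 2 * d * sum (map f xs) ≤ 2 * d * count dense? xs * M + length xs * M
  bound []       = subst (_≤ 2 * d * 0 * M + 0) (sym (*-zeroʳ (2 * d))) z≤n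
  bound (x ∷ xs) with dense? x
  ... | yes _ = begin
    2 * d * (f x + sum (map f xs))  ≡⟨ *-distribˡ-+ (2 * d) (f x) _ ⟩
    2 * d * f x + 2 * d * sum (map f xs)
      ≤⟨ +-mono-≤ (*-monoʳ-≤ (2 * d) (f≤M x))
           (≤-trans (bound xs)
             (+-monoʳ-≤ (2 * d * count dense? xs * M) (m≤n+m (length xs * M) M))) ⟩
    2 * d * M + (2 * d * count dense? xs * M + (M + length xs * M))
      ≡⟨ solve 4 (λ e M c l → e :* M :+ (e :* c :* M :+ (M :+ l))
             := e :* (con 1 :+ c) :* M :+ (M :+ l)) refl
           (2 * d) M (count dense? xs) (length xs * M) ⟩
    2 * d * suc (count dense? xs) * M + (M + length xs * M) ∎
  ... | no M≰ = begin
    2 * d * (f x + sum (map f xs))  ≡⟨ *-distribˡ-+ (2 * d) (f x) _ ⟩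
    2 * d * f x + 2 * d * sum (map f xs)
      ≤⟨ +-mono-≤ (<⇒≤ (≰⇒> M≰)) (bound xs) ⟩
    M + (2 * d * count dense? xs * M + length xs * M)
      ≡⟨ solve 3 (λ M c l → M :+ (c :+ l) := c :+ (M :+ l)) refl
           M (2 * d * count dense? xs * M) (length xs * M) ⟩
    2 * d * count dense? xs * M + (M + length xs * M) ∎

tuples : ∀ r → List A → List (Vec A r)
tuples zero    xs = [] ∷ []
tuples (suc r) xs = cartesianProductWith _∷_ xs (tuples r xs)

length-tuples : ∀ r (xs : List A) → length (tuples r xs) ≡ length xs ^ r
length-tuples zero    xs = refl
length-tuples (suc r) xs = trans (length-cartesianProductWith _∷_ xs (tuples r xs))
  (cong (length xs *_) (length-tuples r xs))

-- Averaging gives t = 2dm elements with dense links, of which m have a dense common link by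
-- pigeonhole.
denseCommonLink : ∀ r m d → .{{NonZero d}} → (xs : List A) → .{{NonZero (length xs)}} →
  2 * d * (2 * d * m) ≤ length xs →
  {R : Vec A (suc r) → Set} (R? : Decidable R) →
  length xs ^ suc r ≤ d * count R? (tuples (suc r) xs) →
  ∃ λ S → S ⊑ xs × length S ≡ m ×
    length xs ^ r ≤ suc (2 ^ (2 * d * m)) * count (common? (λ x → R? ∘ (x ∷_)) S) (tuples r xs)
denseCommonLink {A} r m d xs big R? dense =
  conclude (commonNeighbours (λ x → R? ∘ (x ∷_)) M D m T (tuples r xs))
  where
  open ≤-Reasoning
  M = length xs ^ r
  t = 2 * d * m
  -- One more than `2 ^ t`: if pigeonhole fails, cancelling `D * (m * M)` leaves
  -- `D * M ≤ 2 ^ t * M`, which is impossible for positive `M`.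
  D = suc (2 ^ t)
  link : A → ℕ
  link x = count (R? ∘ (x ∷_)) (tuples r xs)
  dense? : Decidable (λ x → M ≤ 2 * d * link x)
  dense? x = M ≤? 2 * d * link x
  -- Exactly `t` dense elements are kept, so that the factor `2 ^ length T` does not grow with `xs`.
  T = take t (filter dense? xs)
  instance
    M≢0 : NonZero M
    M≢0 = m^n≢0 (length xs) r
    2d≢0 : NonZero (2 * d)
    2d≢0 = m*n≢0 2 d
  link≤M : ∀ x → link x ≤ M
  link≤M x = ≤-trans (length-filter (R? ∘ (x ∷_)) (tuples r xs)) (≤-reflexive (length-tuples r xs))
  t≤ : t ≤ count dense? xs
  t≤ = *-cancelˡ-≤ (2 * d) (≤-trans big
    (length≤*count-dense link M d link≤M dense? xs
      (subst (λ c → length xs * M ≤ d * c)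
        (count-cartesianProductWith R? _∷_ xs (tuples r xs)) dense)))
  ∣T∣≡t : length T ≡ t
  ∣T∣≡t = trans (length-take t (filter dense? xs)) (m≤n⇒m⊓n≡m t≤)
  T-dense : All (λ x → M ≤ 2 * d * link x) T
  T-dense = All-resp-⊆ (take-⊆ t _) (all-filter dense? xs)
  m*M≤ : m * M ≤ sum (map link T)
  -- The t = 2dm elements of `T` have links of size at least M / 2d each.
  m*M≤ = *-cancelˡ-≤ (2 * d) (begin
    2 * d * (m * M)
      ≡⟨ *-assoc (2 * d) m M ⟨
    t * M
      ≡⟨ cong (_* M) (trans (cong length (filter-all dense? T-dense)) ∣T∣≡t) ⟨
    count dense? T * M
      ≤⟨ count*≤*sum dense? link (2 * d) M (λ M≤ → M≤) T ⟩
    2 * d * sum (map link T) ∎)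
  conclude : _ ⊎ _ → _
  conclude (inj₁ (S , S⊑T , ∣S∣ , M≤)) =
    S , ⊑-trans S⊑T (⊑-trans (take-⊆ t _) (filter-⊆ dense? xs)) , ∣S∣ , M≤
  conclude (inj₂ le) = contradiction (*-cancelʳ-≤ D (2 ^ t) M D*M≤) (<⇒≱ ≤-refl)
    where
    D*M≤ : D * M ≤ 2 ^ t * M
    D*M≤ = +-cancelˡ-≤ (D * (m * M)) _ _ (begin
      D * (m * M) + D * M
        ≡⟨ *-distribˡ-+ D (m * M) M ⟨
      D * (m * M + M)
        ≤⟨ *-monoʳ-≤ D (+-monoˡ-≤ M m*M≤) ⟩
      D * (sum (map link T) + M)
        ≤⟨ subst₂ (λ l k → D * (sum (map link T) + l) ≤ D * (m * l) + 2 ^ k * M)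
             (length-tuples r xs) ∣T∣≡t le ⟩
      D * (m * M) + 2 ^ t * M ∎)

-- The first bound guarantees 2dm dense elements in the averaging step. The second serves the
-- recursion, in which the density 1 / d has dropped to 1 / (1 + 2 ^ (2dm)).
threshold : (r m d : ℕ) → ℕ
threshold zero    m d = 0
threshold (suc r) m d = 2 * d * (2 * d * m) ⊔ threshold r m (suc (2 ^ (2 * d * m)))

-- Erdős, On extremal problems of graphs and generalized graphs (1964).
denseRelation⇒block : ∀ r m d → .{{NonZero d}} → {xs : List A} → Unique xs →
  .{{NonZero (length xs)}} → threshold r m d ≤ length xs →
  {R : Vec A r → Set} (R? : Decidable R) → length xs ^ r ≤ d * count R? (tuples r xs) →
  ∃ λ (Ss : Vec (List A) r) →
    VecAll.All (λ S → Unique S × length S ≡ m) Ss × (∀ {v} → Pointwise _∈ₗ_ v Ss → R v)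
denseRelation⇒block zero m d unique big R? dense with R? []
... | yes R[] = [] , VecAll.[] , λ { [] → R[] }
-- Without `[]` the count is 0, against `length xs ^ 0 = 1`.
... | no _    = contradiction (subst (1 ≤_) (*-zeroʳ d) dense) λ ()
denseRelation⇒block (suc r) m d {xs} unique big R? dense =
  -- The common link of `S` is again a dense relation, of arity one less; prefixing `S` to a block
  -- for it gives a block for `R`.
  let S , S⊑xs , ∣S∣ , dense′ = denseCommonLink r m d xs (≤-trans (m≤m⊔n _ _) big) R? dense
      Ss , parts , block = denseRelation⇒block r m (suc (2 ^ (2 * d * m))) unique
        (≤-trans (m≤n⊔m (2 * d * (2 * d * m)) _) big) (common? (λ x → R? ∘ (x ∷_)) S) dense′
  in S ∷ Ss , (Unique-resp-⊑ S⊑xs unique , ∣S∣) VecAll.∷ parts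
     , λ { (x∈S ∷ v∈Ss) → All.lookup (block v∈Ss) x∈S }

-- Cardinalities of finite subsets.

∣p∣<∣q∣⇒∃ : ∣ p ∣ < ∣ q ∣ → ∃ λ x → x ∈ q × x ∉ p
∣p∣<∣q∣⇒∃ {p = p} {q} ∣p∣<∣q∣ with Fin.any? (λ x → (x ∈? q) ×-dec ¬? (x ∈? p))
... | yes x = x
... | no ∄x = contradiction (p⊆q⇒∣p∣≤∣q∣ q⊆p) (<⇒≱ ∣p∣<∣q∣)
  where
  q⊆p : q ⊆ p
  q⊆p {x} x∈q with x ∈? p
  ... | yes x∈p = x∈p
  ... | no x∉p  = contradiction (x , x∈q , x∉p) ∄x

p⊆q∧∣q∣≤∣p∣⇒p≡q : p ⊆ q → ∣ q ∣ ≤ ∣ p ∣ → p ≡ q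
p⊆q∧∣q∣≤∣p∣⇒p≡q {p = p} {q} p⊆q ∣q∣≤∣p∣ = ⊆-antisym p⊆q q⊆p
  where
  q⊆p : q ⊆ p
  q⊆p {x} x∈q with x ∈? p
  ... | yes x∈p = x∈p
  ... | no x∉p  = contradiction ∣q∣≤∣p∣ (<⇒≱ (p⊂q⇒∣p∣<∣q∣ (p⊆q , x , x∈q , x∉p)))

∣p∪⁅x⁆∣ : ∀ {x} (p : Subset n) → x ∉ p → ∣ p ∪ ⁅ x ⁆ ∣ ≡ suc ∣ p ∣
∣p∪⁅x⁆∣ {x = zero}  (inside  ∷ p) x∉p = contradiction here x∉p
∣p∪⁅x⁆∣ {x = zero}  (outside ∷ p) x∉p = cong (suc ∘ ∣_∣) (∪-identityʳ p)
∣p∪⁅x⁆∣ {x = suc x} (inside  ∷ p) x∉p = cong suc (∣p∪⁅x⁆∣ p (x∉p ∘ there))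
∣p∪⁅x⁆∣ {x = suc x} (outside ∷ p) x∉p = ∣p∪⁅x⁆∣ p (x∉p ∘ there)

∪⁅⁆-⊆ : ∀ {x} → p ⊆ q → x ∈ q → p ∪ ⁅ x ⁆ ⊆ q
∪⁅⁆-⊆ {p = p} {q} {x} p⊆q x∈q y∈ with x∈p∪q⁻ p ⁅ x ⁆ y∈
... | inj₁ y∈p = p⊆q y∈p
... | inj₂ y∈x = subst (_∈ q) (sym (x∈⁅y⁆⇒x≡y x y∈x)) x∈q

x∉p-x : ∀ {x} (p : Subset n) → x ∉ p - x
x∉p-x {x = zero}  (_ ∷ p) ()
x∉p-x {x = suc x} (_ ∷ p) (there x∈) = x∉p-x p x∈

p-x∪⁅x⁆≡p : ∀ {x} → x ∈ p → (p - x) ∪ ⁅ x ⁆ ≡ p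
p-x∪⁅x⁆≡p {p = p} {x} x∈p = ⊆-antisym (∪⁅⁆-⊆ (p─q⊆p p ⁅ x ⁆) x∈p) p⊆
  where
  p⊆ : p ⊆ (p - x) ∪ ⁅ x ⁆
  p⊆ {y} y∈p with y Fin.≟ x
  ... | yes refl = q⊆p∪q (p - x) ⁅ x ⁆ (x∈⁅x⁆ x)
  ... | no y≢x   = p⊆p∪q ⁅ x ⁆ (x∈p∧x≢y⇒x∈p-y y∈p y≢x)

∣p∣≡1+∣p-x∣ : ∀ {x} → x ∈ p → ∣ p ∣ ≡ suc ∣ p - x ∣
∣p∣≡1+∣p-x∣ {p = p} {x} x∈p =
  trans (cong ∣_∣ (sym (p-x∪⁅x⁆≡p x∈p))) (∣p∪⁅x⁆∣ (p - x) (x∉p-x p))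

-- Each element of `p` in turn uses up its image: the image is deleted from `q`, and injectivity
-- keeps all later images in what remains.
injection⇒∣p∣≤∣q∣ : (f : Fin m → Fin n) → Injective _≡_ _≡_ f → (p : Subset m) (q : Subset n) →
                    (∀ {x} → x ∈ p → f x ∈ q) → ∣ p ∣ ≤ ∣ q ∣
injection⇒∣p∣≤∣q∣ f inj []            q f∈ = z≤n
injection⇒∣p∣≤∣q∣ f inj (outside ∷ p) q f∈ =
  injection⇒∣p∣≤∣q∣ (f ∘ suc) (Fin.suc-injective ∘ inj) p q (f∈ ∘ there)
injection⇒∣p∣≤∣q∣ f inj (inside ∷ p)  q f∈ = subst (_ ≤_) (sym (∣p∣≡1+∣p-x∣ (f∈ here)))
  (s≤s (injection⇒∣p∣≤∣q∣ (f ∘ suc) (Fin.suc-injective ∘ inj) p (q - f zero)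
    λ x∈p → x∈p∧x≢y⇒x∈p-y (f∈ (there x∈p)) (λ eq → contradiction (inj eq) λ ())))

∣image∣ : {f : Fin m → Fin n} → Injective _≡_ _≡_ f → ∀ p → ∣ p ∣ ≤ ∣ image f p ∣
∣image∣ {f = f} inj p = injection⇒∣p∣≤∣q∣ f inj p (image f p) (∈-image⁺ f)

-- Counting the ordered tuples that complete a set to an edge.

module _ (H : RGraph r n) where

  extension? : ∀ s → Decidable (λ x → x ∉ s × Edge H (s ∪ ⁅ x ⁆))
  extension? s x = ¬? (x ∈? s) ×-dec Edge? H (s ∪ ⁅ x ⁆)

  -- An edge containing an (r-1)-set `s` is `s` together with one further vertex, so the edges
  -- counted, which are distinct, all arise from extension vertices.
  degree≤count-extension : ∀ s → suc ∣ s ∣ ≡ r → degree H s ≤ count (extension? s) (allFin n)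
  degree≤count-extension s 1+∣s∣≡r =
    subst (degree H s ≤_) (length-map (λ x → s ∪ ⁅ x ⁆) extensions)
      (Unique⇒length≤ (Unique.filter⁺ edge⊇s? (subsets-unique n))
        (extend ∘ proj₂ ∘ ∈-filter⁻ edge⊇s? {xs = subsets n}))
    where
    edge⊇s? = λ e → Edge? H e ×-dec (s ⊆? e)
    extensions = filter (extension? s) (allFin n)
    extend : ∀ {e} → Edge H e × s ⊆ e → e ∈ₗ map (λ x → s ∪ ⁅ x ⁆) extensions
    extend {e} (He , s⊆e)
      with x , x∈e , x∉s ← ∣p∣<∣q∣⇒∃ {p = s} {q = e}
             (≤-reflexive (trans 1+∣s∣≡r (sym (uniform H He)))) =
      subst (_∈ₗ _) s∪x≡e (∈-map⁺ (λ x → s ∪ ⁅ x ⁆)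
        (∈-filter⁺ (extension? s) (∈-allFin x) (x∉s , subst (Edge H) (sym s∪x≡e) He)))
      where
      s∪x≡e : s ∪ ⁅ x ⁆ ≡ e
      s∪x≡e = p⊆q∧∣q∣≤∣p∣⇒p≡q (∪⁅⁆-⊆ s⊆e x∈e)
        (≤-reflexive (trans (uniform H He) (sym (trans (∣p∪⁅x⁆∣ s x∉s) 1+∣s∣≡r))))

  -- For `s = ⊥` these are the orderings of the edges. The accumulated set makes the recursion match
  -- that of `tuples`, and recording that each entry is new makes distinctness of the entries
  -- directly available.
  Completes : ∀ {j} → Subset n → Vec (Fin n) j → Set
  Completes s []      = Edge H s
  Completes s (x ∷ v) = x ∉ s × Completes (s ∪ ⁅ x ⁆) v

  Completes? : ∀ {j} s → Decidable (Completes {j} s)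
  Completes? s []      = Edge? H s
  Completes? s (x ∷ v) = ¬? (x ∈? s) ×-dec Completes? (s ∪ ⁅ x ⁆) v

  completes-∉ : ∀ {j} s (v : Vec (Fin n) j) → Completes s v → ∀ i → lookup v i ∉ s
  completes-∉ s (x ∷ v) (x∉s , _) zero    = x∉s
  completes-∉ s (x ∷ v) (_ , c)   (suc i) = completes-∉ (s ∪ ⁅ x ⁆) v c i ∘ p⊆p∪q ⁅ x ⁆

  completes-injective : ∀ {j} s (v : Vec (Fin n) j) → Completes s v → Injective _≡_ _≡_ (lookup v)
  completes-injective s (x ∷ v) (_ , c) {zero}  {zero}  _  = refl
  completes-injective s (x ∷ v) (_ , c) {zero}  {suc k} eq =
    contradiction (q⊆p∪q s ⁅ x ⁆ (subst (_∈ ⁅ x ⁆) eq (x∈⁅x⁆ x)))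
      (completes-∉ (s ∪ ⁅ x ⁆) v c k)
  completes-injective s (x ∷ v) (_ , c) {suc i} {zero}  eq =
    contradiction (q⊆p∪q s ⁅ x ⁆ (subst (_∈ ⁅ x ⁆) (sym eq) (x∈⁅x⁆ x)))
      (completes-∉ (s ∪ ⁅ x ⁆) v c i)
  completes-injective s (x ∷ v) (_ , c) {suc i} {suc k} eq =
    cong suc (completes-injective (s ∪ ⁅ x ⁆) v c eq)

  completes-edge : ∀ {j} s (v : Vec (Fin n) j) → Completes s v →
                   ∃ λ e → Edge H e × s ⊆ e × (∀ i → lookup v i ∈ e)
  completes-edge s []      c       = s , c , (λ x∈s → x∈s) , λ ()
  completes-edge s (x ∷ v) (_ , c) =
    let e , He , s∪x⊆e , v∈e = completes-edge (s ∪ ⁅ x ⁆) v c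
    in e , He , s∪x⊆e ∘ p⊆p∪q ⁅ x ⁆ , λ where
      zero    → s∪x⊆e (q⊆p∪q s ⁅ x ⁆ (x∈⁅x⁆ x))
      (suc i) → v∈e i

  -- The extended set need only lie inside an edge, so that extensions can be iterated from sets of
  -- any size below r.
  ExtendsInEdge : Subset n → Fin n → Set
  ExtendsInEdge s x = x ∉ s × ∃ λ e → Edge H e × s ∪ ⁅ x ⁆ ⊆ e

  ExtendsInEdge? : ∀ s → Decidable (ExtendsInEdge s)
  ExtendsInEdge? s x = ¬? (x ∈? s) ×-dec anySubset? (λ e → Edge? H e ×-dec ((s ∪ ⁅ x ⁆) ⊆? e))

  module _ {k : ℕ} (codegree : CodegreeAtLeast H k) where

    -- Delete from `e` a vertex `z` outside `s`. The (r-1)-set `e - z` still contains `s` and has at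
    -- least `k` extensions to an edge, each of which also extends `s` inside that edge.
    codegree≤extensions : ∀ {s e} → Edge H e → s ⊆ e → ∣ s ∣ < r →
                          k ≤ count (ExtendsInEdge? s) (allFin n)
    codegree≤extensions {s} {e} He s⊆e ∣s∣<r
      with z , z∈e , z∉s ← ∣p∣<∣q∣⇒∃ {p = s} {q = e} (subst (∣ s ∣ <_) (sym (uniform H He)) ∣s∣<r) =
      ≤-trans (codegree (e - z) (cong (_∸ 1) 1+∣e-z∣≡r) (e , He , p─q⊆p e ⁅ z ⁆))
        (≤-trans (degree≤count-extension (e - z) 1+∣e-z∣≡r)
          (count-mono (extension? (e - z)) (ExtendsInEdge? s) shrink (allFin n)))
      where
      1+∣e-z∣≡r : suc ∣ e - z ∣ ≡ r
      1+∣e-z∣≡r = trans (sym (∣p∣≡1+∣p-x∣ z∈e)) (uniform H He)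
      s⊆e-z : s ⊆ e - z
      s⊆e-z y∈s = x∈p∧x≢y⇒x∈p-y (s⊆e y∈s) λ { refl → z∉s y∈s }
      shrink : ∀ {x} → x ∉ e - z × Edge H ((e - z) ∪ ⁅ x ⁆) → ExtendsInEdge s x
      shrink {x} (x∉ , Hx) = x∉ ∘ s⊆e-z , _ , Hx ,
        ∪⁅⁆-⊆ (p⊆p∪q ⁅ x ⁆ ∘ s⊆e-z) (q⊆p∪q (e - z) ⁅ x ⁆ (x∈⁅x⁆ x))

    -- At least `k` choices of the next entry keep the set inside an edge, and induction applies to
    -- each of them.
    codegree^≤count-completes : ∀ j {s e} → Edge H e → s ⊆ e → ∣ s ∣ + j ≡ r →
                                k ^ j ≤ count (Completes? s) (tuples j (allFin n))
    codegree^≤count-completes zero {s} {e} He s⊆e ∣s∣≡r =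
      -- Here `s` has size r and so equals `e`: the empty tuple completes it.
      ≤-reflexive (sym (cong length
        (filter-accept (Completes? s) {[]} {[]} (subst (Edge H) (sym s≡e) He))))
      where
      s≡e = p⊆q∧∣q∣≤∣p∣⇒p≡q s⊆e
        (≤-reflexive (trans (uniform H He) (trans (sym ∣s∣≡r) (+-identityʳ _))))
    codegree^≤count-completes (suc j) {s} {e} He s⊆e ∣s∣+1+j≡r = begin
      k * k ^ j
        ≤⟨ *-monoˡ-≤ (k ^ j)
             (codegree≤extensions He s⊆e (subst (∣ s ∣ <_) ∣s∣+1+j≡r (m<m+n ∣ s ∣ z<s))) ⟩
      count (ExtendsInEdge? s) (allFin n) * k ^ j
        ≤⟨ count*≤*sum (ExtendsInEdge? s) completions 1 (k ^ j) (λ {x} → step {x}) (allFin n) ⟩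
      1 * sum (map completions (allFin n))
        ≡⟨ *-identityˡ _ ⟩
      sum (map completions (allFin n))
        ≡⟨ count-cartesianProductWith (Completes? s) _∷_ (allFin n) (tuples j (allFin n)) ⟨
      count (Completes? s) (tuples (suc j) (allFin n)) ∎
      where
      open ≤-Reasoning
      completions : Fin n → ℕ
      completions x = count (Completes? s ∘ (x ∷_)) (tuples j (allFin n))
      step : ∀ {x} → ExtendsInEdge s x → k ^ j ≤ 1 * completions x
      step {x} (x∉s , e , He , s∪x⊆e) = begin
        k ^ j
          ≤⟨ codegree^≤count-completes j He s∪x⊆e
               (trans (cong (_+ j) (∣p∪⁅x⁆∣ s x∉s)) (trans (sym (+-suc ∣ s ∣ j)) ∣s∣+1+j≡r)) ⟩
        count (Completes? (s ∪ ⁅ x ⁆)) (tuples j (allFin n))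
          ≤⟨ count-mono (Completes? (s ∪ ⁅ x ⁆)) (Completes? s ∘ (x ∷_)) (x∉s ,_)
               (tuples j (allFin n)) ⟩
        completions x
          ≡⟨ *-identityˡ _ ⟨
        1 * completions x ∎

-- Embedding an r-partite r-graph into a block.

enumerate : {S : List A} → Unique S → length S ≡ m →
            ∃ λ (g : Fin m → A) → Injective _≡_ _≡_ g × (∀ i → g i ∈ₗ S)
enumerate {S = S} unique refl = List.lookup S , lookup-injective unique , λ i → ∈-lookup {xs = S} i

tabulate-∈ : {f : Fin r → A} (Ss : Vec (List A) r) → (∀ i → f i ∈ₗ lookup Ss i) →
             Pointwise _∈ₗ_ (tabulate f) Ss
tabulate-∈ []       f∈ = []
tabulate-∈ (S ∷ Ss) f∈ = f∈ zero ∷ tabulate-∈ Ss (f∈ ∘ suc)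

module _ (F : RGraph r m) {class : Fin m → Fin r}
         (partite : ∀ {e} → Edge F e → ∀ {x y} → x ∈ e → y ∈ e → class x ≡ class y → x ≡ y)
         (H : RGraph r n) {Ss : Vec (List (Fin n)) r}
         (parts : VecAll.All (λ S → Unique S × length S ≡ m) Ss)
         (block : {v : Vec (Fin n) r} → Pointwise _∈ₗ_ v Ss → Completes H ⊥ v) where

  private
    part : ∀ i → ∃ λ (g : Fin m → Fin n) → Injective _≡_ _≡_ g × (∀ x → g x ∈ₗ lookup Ss i)
    part i = let unique , ∣S∣≡m = VecAll.lookup⁺ parts i in enumerate unique ∣S∣≡m

    -- Every part has room for all of `Fin m`, so each vertex keeps its own index within the part of
    -- its class and class sizes need not be tracked.
    embed : Fin m → Fin n
    embed x = proj₁ (part (class x)) x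

    selection : (Fin r → Fin m) → Vec (Fin n) r
    selection c = tabulate λ i → proj₁ (part i) (c i)

    selection-completes : ∀ c → Completes H ⊥ (selection c)
    selection-completes c = block (tabulate-∈ Ss λ i → proj₂ (proj₂ (part i)) (c i))

    lookup-selection : ∀ c {x} → c (class x) ≡ x → lookup (selection c) (class x) ≡ embed x
    lookup-selection c {x} eq =
      trans (lookup∘tabulate _ (class x)) (cong (proj₁ (part (class x))) eq)

    -- A set that meets each class at most once determines a vertex in every class it meets; the
    -- other classes receive the default `x₀`.
    transversal : (x₀ : Fin m) (e : Subset m) →
                  (∀ {x y} → x ∈ e → y ∈ e → class x ≡ class y → x ≡ y) →
                  ∃ λ (c : Fin r → Fin m) → ∀ {x} → x ∈ e → c (class x) ≡ x
    transversal x₀ e inj = (λ i → pick (find i)) , λ {x} x∈e → pick-class x∈e (find (class x))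
      where
      find : ∀ i → Dec (∃ λ y → y ∈ e × class y ≡ i)
      find i = Fin.any? λ y → (y ∈? e) ×-dec (class y Fin.≟ i)
      pick : ∀ {i} → Dec (∃ λ y → y ∈ e × class y ≡ i) → Fin m
      pick (yes (y , _)) = y
      -- The default serves only as an index into the part and need not lie in the class concerned.
      pick (no _)        = x₀
      pick-class : ∀ {x} → x ∈ e → (d : Dec (∃ λ y → y ∈ e × class y ≡ class x)) → pick d ≡ x
      pick-class x∈e (yes (y , y∈e , eq)) = inj y∈e x∈e eq
      pick-class x∈e (no ∄y)              = contradiction (_ , x∈e , refl) ∄y

    -- Within one class this is injectivity of a single enumeration. For two classes, some tuple of
    -- the block has both images at different positions, and its entries are distinct; this supplies
    -- the disjointness of the parts.
    embed-injective : Injective _≡_ _≡_ embed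
    embed-injective {x} {y} eq with class x Fin.≟ class y
    ... | yes same = proj₁ (proj₂ (part (class y)))
                       (trans (cong (λ i → proj₁ (part i) x) (sym same)) eq)
    ... | no differ = contradiction (completes-injective H ⊥ (selection c) (selection-completes c)
                        (trans (lookup-selection c (c-class (p⊆p∪q ⁅ y ⁆ (x∈⁅x⁆ x)))) (trans eq (sym
                          (lookup-selection c (c-class (q⊆p∪q ⁅ x ⁆ ⁅ y ⁆ (x∈⁅x⁆ y)))))))) differ
      where
      member : ∀ {z} → z ∈ ⁅ x ⁆ ∪ ⁅ y ⁆ → z ≡ x ⊎ z ≡ y
      member z∈ = [ inj₁ ∘ x∈⁅y⁆⇒x≡y x , inj₂ ∘ x∈⁅y⁆⇒x≡y y ]′ (x∈p∪q⁻ ⁅ x ⁆ ⁅ y ⁆ z∈)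
      distinct : ∀ {z w} → z ∈ ⁅ x ⁆ ∪ ⁅ y ⁆ → w ∈ ⁅ x ⁆ ∪ ⁅ y ⁆ → class z ≡ class w → z ≡ w
      distinct z∈ w∈ same with member z∈ | member w∈
      ... | inj₁ refl | inj₁ refl = refl
      ... | inj₁ refl | inj₂ refl = contradiction same differ
      ... | inj₂ refl | inj₁ refl = contradiction (sym same) differ
      ... | inj₂ refl | inj₂ refl = refl
      c = proj₁ (transversal x (⁅ x ⁆ ∪ ⁅ y ⁆) distinct)
      c-class = proj₂ (transversal x (⁅ x ⁆ ∪ ⁅ y ⁆) distinct)

    -- The image of `e` lies in the edge spanned by a selection that agrees with `e`, and both have
    -- r vertices.
    embed-edge : 1 ≤ r → ∀ e → Edge F e → Edge H (image embed e)
    embed-edge 1≤r e Fe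
      -- Since r ≥ 1 the edge `e` has a vertex, which serves as the default for `transversal`.
      with x₀ , _ ← ∣p∣<∣q∣⇒∃ {p = ⊥} {q = e} (subst₂ _<_ (sym (∣⊥∣≡0 m)) (sym (uniform F Fe)) 1≤r)
      with c , c-class ← transversal x₀ e (partite Fe)
      with E , HE , _ , v∈E ← completes-edge H ⊥ (selection c) (selection-completes c) =
      subst (Edge H) (sym image≡E) HE
      where
      image⊆E : image embed e ⊆ E
      image⊆E j∈ with i , i∈e , refl ← ∈-image⁻ embed j∈ =
        subst (_∈ E) (lookup-selection c (c-class i∈e)) (v∈E (class i))
      image≡E : image embed e ≡ E
      image≡E = p⊆q∧∣q∣≤∣p∣⇒p≡q image⊆E
        (subst (_≤ ∣ image embed e ∣) (trans (uniform F Fe) (sym (uniform H HE)))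
          (∣image∣ embed-injective e))

  block⇒contains : 1 ≤ r → Contains H F
  block⇒contains 1≤r = embed , embed-injective , embed-edge 1≤r

-- From large positive co-degree to the limit.

^-distribʳ-* : ∀ r a b → (a * b) ^ r ≡ a ^ r * b ^ r
^-distribʳ-* zero    a b = refl
^-distribʳ-* (suc r) a b = trans (cong (a * b *_) (^-distribʳ-* r a b))
  ([m*n]*[o*p]≡[m*o]*[n*p] a b (a ^ r) (b ^ r))

-- Raising `n ≤ d * k` to the power r turns the `k ^ r` orderings of edges grown from the empty set
-- into density at least 1 / d ^ r among all r-tuples.
codegree⇒contains : ∀ d → .{{NonZero d}} → 1 ≤ r → (F : RGraph r m) → RPartite F →
  .{{NonZero n}} → threshold r m (d ^ r) ≤ n →
  (H : RGraph r n) → ∃ (Edge H) → ∀ {k} → CodegreeAtLeast H k → n ≤ d * k → Contains H F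
codegree⇒contains {r} {m} {n} d 1≤r F (_ , partite) {{n≢0}} big H (e , He) {k} codegree n≤d*k =
  let Ss , parts , block = denseRelation⇒block r m (d ^ r) {{m^n≢0 d r}} (Unique.allFin⁺ n)
        {{subst NonZero (sym ∣Fin∣) n≢0}} (subst (threshold r m (d ^ r) ≤_) (sym ∣Fin∣) big)
        (Completes? H ⊥) dense
  in block⇒contains F partite H parts block 1≤r
  where
  open ≤-Reasoning
  ∣Fin∣ : length (allFin n) ≡ n
  ∣Fin∣ = length-tabulate {n = n} (λ i → i)
  dense : length (allFin n) ^ r ≤ d ^ r * count (Completes? H ⊥) (tuples r (allFin n))
  dense = begin
    length (allFin n) ^ r
      ≡⟨ cong (_^ r) ∣Fin∣ ⟩
    n ^ r
      ≤⟨ ^-monoˡ-≤ r n≤d*k ⟩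
    (d * k) ^ r
      ≡⟨ ^-distribʳ-* r d k ⟩
    d ^ r * k ^ r
      ≤⟨ *-monoʳ-≤ (d ^ r)
           (codegree^≤count-completes H codegree r He (⊆-min e) (cong (_+ r) (∣⊥∣≡0 n))) ⟩
    d ^ r * count (Completes? H ⊥) (tuples r (allFin n)) ∎

d*co⁺ex<n : ∀ d → .{{NonZero d}} → 1 ≤ r → (F : RGraph r m) → RPartite F →
  ∀ n → .{{NonZero n}} → threshold r m (d ^ r) ≤ n → d * co⁺ex n F < n
d*co⁺ex<n d 1≤r F partite n big with co⁺ex-attained n F
... | inj₁ eq rewrite eq | *-zeroʳ d = >-nonZero⁻¹ n
... | inj₂ (H , free , eq) rewrite eq with anySubset? (Edge? H)
-- Without edges the co-degree condition is vacuous for every k, so the convention that `δ⁺` is 0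
-- settles this case.
...   | no ∄e rewrite δ⁺-empty H ∄e | *-zeroʳ d = >-nonZero⁻¹ n
...   | yes ∃e = ≰⇒> λ n≤ → free (codegree⇒contains d 1≤r F partite big H ∃e (δ⁺-satisfies H) n≤)

-- A positive `ε` has numerator at least 1, so it is at least the reciprocal of its denominator, and
-- k / n lies below that.
∣k/n-0∣<ε : ∀ {k n} → .{{_ : NonZero n}} → ∀ ε → 0ℚ ℚ.< ε → ℚ.↧ₙ ε * k < n →
            ℚ.∣ ℤ.+ k ℚ./ n ℚ.- 0ℚ ∣ ℚ.< ε
∣k/n-0∣<ε {k} {n@(suc n-1)} ε@(mkℚ (ℤ.+ suc a) d-1 _) 0<ε small =
  subst (ℚ._< ε) (sym ∣k/n-0∣≡k/n) (ℚ.toℚᵘ-cancel-<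
    (ℚᵘ.<-respˡ-≃ (ℚᵘ.≃-sym (ℚ.toℚᵘ-fromℚᵘ (ℚᵘ.mkℚᵘ (ℤ.+ k) n-1)))
      (ℚᵘ.*<* cross)))
  where
  open ≤-Reasoning
  ∣k/n-0∣≡k/n : ℚ.∣ ℤ.+ k ℚ./ n ℚ.- 0ℚ ∣ ≡ ℤ.+ k ℚ./ n
  ∣k/n-0∣≡k/n = trans (cong ℚ.∣_∣ (ℚ.+-identityʳ (ℤ.+ k ℚ./ n)))
    (ℚ.0≤p⇒∣p∣≡p (ℚ.nonNegative⁻¹ (ℤ.+ k ℚ./ n) {{ℚ.normalize-nonNeg k n}}))
  cross : ℤ.+ k ℤ.* ℤ.+ suc d-1 ℤ.< ℤ.+ suc a ℤ.* ℤ.+ n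
  cross = subst₂ ℤ._<_ (ℤ.pos-* k (suc d-1)) (ℤ.pos-* (suc a) n) (ℤ.+<+ (begin-strict
    k * suc d-1  ≡⟨ *-comm k (suc d-1) ⟩
    suc d-1 * k  <⟨ small ⟩
    n            ≤⟨ m≤m+n n (a * n) ⟩
    suc a * n    ∎))
∣k/n-0∣<ε (mkℚ (ℤ.+ zero) _ _)    (ℚ.*<* (ℤ.+<+ ())) _
∣k/n-0∣<ε (mkℚ ℤ.-[1+ _ ] _ _)    (ℚ.*<* ()) _

corollary26 : (r m : ℕ) → 2 ≤ r → (F : RGraph r m) → RPartite F → γ⁺[ F ]≡ 0ℚ
-- The parameter d is the denominator of `ε`.
corollary26 r m 2≤r F partite ε 0<ε = threshold r m (ℚ.↧ₙ ε ^ r) , λ n N≤n →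
  ∣k/n-0∣<ε ε 0<ε (d*co⁺ex<n (ℚ.↧ₙ ε) (≤-trans (n≤1+n 1) 2≤r) F partite n N≤n)
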